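{- For each integer $t\ge 1$ let $M_{\mathrm a}(t)$ be the number of $3\times 3$ magic squares with magic sum $t$. Then $$\sum_{t>0} M_{\mathrm a}(t)\,x^t=\frac{8x^{15}(2x^3+1)}{(1-x^3)(1-x^6)(1-x^9)},$$ and for every integer $t\ge 1$ $$M_{\mathrm a}(t)=\begin{cases} \frac{2t^2-32t+144}{9}, & t\equiv 0 \pmod{18},\\[2pt] \frac{2t^2-32t+78}{9}, & t\equiv 3 \pmod{18},\\[2pt] \frac{2t^2-32t+120}{9}, & t\equiv 6 \pmod{18},\\[2pt] \frac{2t^2-32t+126}{9}, & t\equiv 9 \pmod{18},\\[2pt] \frac{2t^2-32t+96}{9}, & t\equiv 12 \pmod{18},\\[2pt] \frac{2t^2-32t+102}{9}, & t\equiv 15 \pmod{18},\\[2pt] 0, & t\not\equiv 0 \pmod 3. \end{cases}$$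
   Context: A $3\times3$ magic square (in the strong sense) is a $3\times 3$ matrix of pairwise distinct positive integers in which all three row sums, all three column sums and both diagonal sums are equal; the common value is the magic sum. Squares are counted as matrices (not up to symmetry). -}

module Defs where

open import Data.Nat.Base as ℕ using (ℕ; zero; suc; _≤_; _<_; s≤s; z≤n)
import Data.Nat.Properties as ℕ
open import Data.Integer.Base as ℤ using (ℤ; +_; 0ℤ; 1ℤ)
import Data.Integer.Properties as ℤ
open import Data.Rational.Base as ℚ using (ℚ)
open import Data.Fin.Base using (Fin; zero; suc; toℕ; opposite)
open import Data.Fin.Properties using (all?; _≟_)
open import Data.Vec.Base as Vec using (Vec; []; _∷_; lookup; tabulate)
open import Data.List.Base as List using (List; length; filter; upTo; cartesianProductWith)
open import Data.List.Membership.Propositional using (_∈_)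
open import Data.List.Membership.Propositional.Properties
  using (∈-map⁺; ∈-upTo⁺; ∈-cartesianProductWith⁺; ∈-filter⁺; ∈-filter⁻)
open import Data.List.Relation.Unary.Any using (here)
open import Data.List.Relation.Unary.All using ([])
open import Data.List.Relation.Unary.AllPairs using ([]; _∷_)
open import Data.List.Relation.Unary.Unique.Propositional using (Unique)
import Data.List.Relation.Unary.Unique.Propositional.Properties as Unique
open import Data.Product.Base using (_×_; _,_; proj₂)
open import Function.Bundles using (_⇔_; mk⇔)
open import Relation.Nullary.Decidable using (Dec; map′; _×-dec_; _→-dec_)
open import Relation.Binary.PropositionalEquality
  using (_≡_; refl; sym; trans; cong; cong₂; subst; _≗_; module ≡-Reasoning)

Square : Set
Square = Vec (Vec ℕ 3) 3

entry : Square → Fin 3 → Fin 3 → ℕ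
entry A i j = lookup (lookup A i) j

record IsMagicSquare (t : ℕ) (A : Square) : Set where
  field
    positive     : ∀ i j → 1 ≤ entry A i j
    distinct     : ∀ i j k l → entry A i j ≡ entry A k l → i ≡ k × j ≡ l
    rowSum       : ∀ i → Vec.sum (lookup A i) ≡ t
    columnSum    : ∀ j → Vec.sum (tabulate λ i → entry A i j) ≡ t
    diagonal     : Vec.sum (tabulate λ i → entry A i i) ≡ t
    antidiagonal : Vec.sum (tabulate λ i → entry A i (opposite i)) ≡ t

isMagicSquare? : ∀ t A → Dec (IsMagicSquare t A)
isMagicSquare? t A = map′
  (λ (p , d , r , c , x , y) → record
    { positive = p ; distinct = d ; rowSum = r ; columnSum = c
    ; diagonal = x ; antidiagonal = y })
  (λ m → let open IsMagicSquare m in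
    positive , distinct , rowSum , columnSum , diagonal , antidiagonal)
  ( all? (λ i → all? λ j → 1 ℕ.≤? entry A i j)
  ×-dec all? (λ i → all? λ j → all? λ k → all? λ l →
          (entry A i j ℕ.≟ entry A k l) →-dec ((i ≟ k) ×-dec (j ≟ l)))
  ×-dec all? (λ i → Vec.sum (lookup A i) ℕ.≟ t)
  ×-dec all? (λ j → Vec.sum (tabulate λ i → entry A i j) ℕ.≟ t)
  ×-dec (Vec.sum (tabulate λ i → entry A i i) ℕ.≟ t)
  ×-dec (Vec.sum (tabulate λ i → entry A i (opposite i)) ℕ.≟ t))

vectors : ∀ {X : Set} → List X → ∀ n → List (Vec X n)
vectors xs zero    = List.[ [] ]
vectors xs (suc n) = cartesianProductWith _∷_ xs (vectors xs n)

-- It suffices to search among squares with entries in {1,…,t}, because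
-- positive entries of a row with sum t are at most t; ∈-magicSquares and
-- magicSquares-unique show that every magic square with sum t is listed
-- exactly once.
magicSquares : ℕ → List Square
magicSquares t =
  filter (isMagicSquare? t) (vectors (vectors (List.map suc (upTo t)) 3) 3)

Mₐ : ℕ → ℕ
Mₐ t = length (magicSquares t)

private
  ∈-vectors : ∀ {X : Set} {xs : List X} {n} (v : Vec X n) →
              (∀ i → lookup v i ∈ xs) → v ∈ vectors xs n
  ∈-vectors []      p = here refl
  ∈-vectors (x ∷ v) p =
    ∈-cartesianProductWith⁺ _∷_ (p zero) (∈-vectors v λ i → p (suc i))

  vectors-unique : ∀ {X : Set} {xs : List X} → Unique xs →
                   ∀ n → Unique (vectors xs n)
  vectors-unique u zero    = [] ∷ []
  vectors-unique u (suc n) = Unique.cartesianProductWith⁺ _∷_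
    (λ { refl → refl , refl }) u (vectors-unique u n)

  lookup≤sum : ∀ {n} (v : Vec ℕ n) i → lookup v i ≤ Vec.sum v
  lookup≤sum (x ∷ v) zero    = ℕ.m≤m+n x _
  lookup≤sum (x ∷ v) (suc i) = ℕ.≤-trans (lookup≤sum v i) (ℕ.m≤n+m _ x)

  ∈-range : ∀ {t m} → 1 ≤ m → m ≤ t → m ∈ List.map suc (upTo t)
  ∈-range {m = suc _} _ m≤t = ∈-map⁺ suc (∈-upTo⁺ m≤t)

∈-magicSquares : ∀ t A → (A ∈ magicSquares t) ⇔ IsMagicSquare t A
∈-magicSquares t A = mk⇔
  (λ A∈ → proj₂ (∈-filter⁻ (isMagicSquare? t) {xs = vectors (vectors (List.map suc (upTo t)) 3) 3} A∈))
  (λ m → let open IsMagicSquare m in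
    ∈-filter⁺ (isMagicSquare? t)
      (∈-vectors A λ i → ∈-vectors (lookup A i) λ j →
        ∈-range (positive i j)
          (subst (entry A i j ≤_) (rowSum i) (lookup≤sum (lookup A i) j)))
      m)

magicSquares-unique : ∀ t → Unique (magicSquares t)
magicSquares-unique t = Unique.filter⁺ (isMagicSquare? t)
  (vectors-unique (vectors-unique
    (Unique.map⁺ ℕ.suc-injective (Unique.upTo⁺ t)) 3) 3)

quad : ℕ → ℕ → ℚ
quad t c = ((+ 2) ℤ.* (+ t) ℤ.^ 2 ℤ.- (+ 32) ℤ.* (+ t) ℤ.+ (+ c)) ℚ./ 9

-- Elements of ℤ[[x]] are represented by their coefficient sequences; two
-- series are equal when they are equal coefficientwise (_≗_).

module PowerSeries where

  open import Algebra.Properties.CommutativeMonoid.Sum ℤ.+-0-commutativeMonoid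
    using (sum)

  Series : Set
  Series = ℕ → ℤ

  infixl 6 _+_ _-_
  infixl 7 _*_ _/_[_]
  infixr 8 _•_
  infix  9 x^_

  _+_ _-_ _*_ : Series → Series → Series
  (f + g) n = f n ℤ.+ g n
  (f - g) n = f n ℤ.- g n
  (f * g) n = sum {suc n} λ k → f (toℕ k) ℤ.* g (n ℕ.∸ toℕ k)

  _•_ : ℤ → Series → Series
  (c • f) n = c ℤ.* f n

  x^_ : ℕ → Series
  (x^ zero)  zero    = 1ℤ
  (x^ zero)  (suc n) = 0ℤ
  (x^ suc k) zero    = 0ℤ
  (x^ suc k) (suc n) = (x^ k) n

  1# : Series
  1# = x^ 0

  -- Long division by a series h with constant term 1: the constant term of
  -- the quotient is g 0, and the rest is the quotient of (g − g₀ h)/x by h.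
  -- By /-* and /-unique, this is the only q with q * h ≗ g.
  divide : Series → Series → Series
  divide g h zero    = g 0
  divide g h (suc n) = divide (λ m → g (suc m) ℤ.- g 0 ℤ.* h (suc m)) h n

  _/_[_] : (g h : Series) → h 0 ≡ 1ℤ → Series
  g / h [ _ ] = divide g h

  private
    x+[y-x] : ∀ x y → x ℤ.+ (y ℤ.- x) ≡ y
    x+[y-x] x y = begin
      x ℤ.+ (y ℤ.- x)      ≡⟨ ℤ.+-comm x (y ℤ.- x) ⟩
      y ℤ.- x ℤ.+ x        ≡⟨ ℤ.+-assoc y (ℤ.- x) x ⟩
      y ℤ.+ (ℤ.- x ℤ.+ x)  ≡⟨ cong (λ z → y ℤ.+ z) (ℤ.+-inverseˡ x) ⟩
      y ℤ.+ 0ℤ             ≡⟨ ℤ.+-identityʳ y ⟩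
      y                    ∎
      where open ≡-Reasoning

    [x+y]-x : ∀ x y → (x ℤ.+ y) ℤ.- x ≡ y
    [x+y]-x x y = trans (ℤ.+-assoc x y (ℤ.- x)) (x+[y-x] x y)

    constant : ∀ (f h : Series) → h 0 ≡ 1ℤ → (f * h) 0 ≡ f 0
    constant f h h₀ = trans (ℤ.+-identityʳ (f 0 ℤ.* h 0))
      (trans (cong (λ z → f 0 ℤ.* z) h₀) (ℤ.*-identityʳ (f 0)))

  /-* : ∀ g h (h₀ : h 0 ≡ 1ℤ) → (g / h [ h₀ ]) * h ≗ g
  /-* g h h₀ zero    = constant (divide g h) h h₀
  /-* g h h₀ (suc n) =
    trans (cong (λ z → g 0 ℤ.* h (suc n) ℤ.+ z) (/-* (λ m → g (suc m) ℤ.- g 0 ℤ.* h (suc m)) h h₀ n))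
          (x+[y-x] (g 0 ℤ.* h (suc n)) (g (suc n)))

  /-unique : ∀ f g h (h₀ : h 0 ≡ 1ℤ) → f * h ≗ g → f ≗ g / h [ h₀ ]
  /-unique f g h h₀ eq zero    = trans (sym (constant f h h₀)) (eq 0)
  /-unique f g h h₀ eq (suc n) = /-unique (λ m → f (suc m)) _ h h₀ tail n
    where
    f₀ : f 0 ≡ g 0
    f₀ = trans (sym (constant f h h₀)) (eq 0)
    tail : (λ m → f (suc m)) * h ≗ (λ m → g (suc m) ℤ.- g 0 ℤ.* h (suc m))
    tail m = trans (sym ([x+y]-x (f 0 ℤ.* h (suc m)) _))
      (cong₂ ℤ._-_ (eq (suc m)) (cong (λ z → z ℤ.* h (suc m)) f₀))

  -- Σ_{t>0} a(t) xᵗ; the value a(0) is not used.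
  ∑₊ : (ℕ → ℕ) → Series
  ∑₊ a zero    = 0ℤ
  ∑₊ a (suc t) = + a (suc t)

{-# OPTIONS --safe #-}
-- A magic square with centre c has sum 3c, and is determined by c and two
-- corners.  Reflections in the middle column, the middle row and the diagonal
-- reduce the count, by a factor of 8, to the squares whose corners decrease in
-- the order top left, top right, bottom left, bottom right.  If the successive
-- differences of these corners are u, 2q, u, the smallest entry is
-- c − (2q + u), and the entries are distinct iff q ≠ u.  So one counts the pairs
-- q ≠ u of positive integers with 2q + u < c; removing (1 , 1) from every pair
-- with both components at least 2 passes from c + 3 to c, which gives a
-- recurrence yielding both the generating function and the quasi-polynomial.
module Submission where

module Pairs where

  open import Data.Nat.Base
  open import Data.Nat.Properties
  open import Data.Nat.Tactic.RingSolver using (solve-∀)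
  open import Data.Empty using (⊥)
  open import Data.List.Base using (List; []; length; map; upTo; _++_)
  open import Data.List.Properties using (length-map; length-++; length-upTo)
  open import Data.List.Membership.Propositional using (_∈_)
  open import Data.List.Membership.Propositional.Properties
    using (∈-map⁺; ∈-map⁻; ∈-++⁺ˡ; ∈-++⁺ʳ; ∈-++⁻; ∈-upTo⁺; ∈-upTo⁻)
  open import Data.List.Membership.Propositional.Properties.WithK using (unique∧set⇒bag)
  open import Data.List.Relation.Binary.BagAndSetEquality using (∼bag⇒↭)
  open import Data.List.Relation.Binary.Permutation.Propositional.Properties using (↭-length)
  open import Data.List.Relation.Unary.AllPairs using ([])
  open import Data.List.Relation.Unary.Unique.Propositional using (Unique)
  open import Data.List.Relation.Binary.Disjoint.Propositional using (Disjoint)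
  import Data.List.Relation.Unary.Unique.Propositional.Properties as Unique
  open import Data.Product.Base using (_×_; _,_; proj₁; proj₂)
  open import Data.Sum.Base using (_⊎_; inj₁; inj₂; [_,_]′)
  open import Function.Base using (_∘_)
  open import Function.Bundles using (_⇔_; mk⇔; Equivalence)
  open import Relation.Binary.PropositionalEquality
  open import Relation.Nullary.Negation.Core using (¬_; contradiction)

  open Equivalence using (to; from)

  -- Duplicate-free enumerations, and lists split by an involution.

  record Enumerates {X : Set} (xs : List X) (P : X → Set) : Set where
    constructor enumerates
    field
      unique  : Unique xs
      members : ∀ x → x ∈ xs ⇔ P x

  open Enumerates

  -- For duplicate-free lists, having the same members means being equal as bags, hence being
  -- permutations of each other.
  length-unique : ∀ {X : Set} {P : X → Set} {xs ys : List X} →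
                  Enumerates xs P → Enumerates ys P → length xs ≡ length ys
  length-unique ex ey = ↭-length (∼bag⇒↭ (unique∧set⇒bag (unique ex) (unique ey)
    λ {x} → mk⇔ (from (members ey x) ∘ to (members ex x))
                (from (members ex x) ∘ to (members ey x))))

  -- `Q` selects exactly one point from each orbit of `f` on `P`: at least one by `cover`, at most
  -- one by `disjoint`, which together also exclude fixed points. So the selected points and their
  -- images list `P` without repetition. Each of the three reflections of a square is handled in
  -- this way.
  ++-involution : ∀ {X : Set} {P Q : X → Set} {f : X → X} {xs : List X} →
                  (∀ x → f (f x) ≡ x) → (∀ {x} → P x → P (f x)) →
                  (∀ {x} → Q x → ¬ Q (f x)) → (∀ {x} → P x → Q x ⊎ Q (f x)) →
                  Enumerates xs (λ x → P x × Q x) → Enumerates (xs ++ map f xs) P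
  ++-involution {P = P} {Q} {f} {xs} ff Pf disjoint cover e = enumerates
    (Unique.++⁺ (unique e)
      (Unique.map⁺ (λ eq → trans (sym (ff _)) (trans (cong f eq) (ff _))) (unique e))
      λ (x∈ , fx∈) → case-map x∈ (∈-map⁻ f fx∈))
    (λ x → mk⇔ (sound x ∘ ∈-++⁻ xs) (complete x))
    where
    case-map : ∀ {x} → x ∈ xs → _ → ⊥
    case-map x∈ (y , y∈ , refl) =
      disjoint (proj₂ (to (members e _) y∈)) (proj₂ (to (members e _) x∈))

    sound : ∀ x → x ∈ xs ⊎ x ∈ map f xs → P x
    sound x (inj₁ x∈) = proj₁ (to (members e x) x∈)
    sound x (inj₂ x∈) with y , y∈ , refl ← ∈-map⁻ f x∈ = Pf (proj₁ (to (members e y) y∈))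

    complete : ∀ x → P x → x ∈ xs ++ map f xs
    complete x p with cover p
    ... | inj₁ q = ∈-++⁺ˡ (from (members e x) (p , q))
    ... | inj₂ q = ∈-++⁺ʳ xs
      (subst (_∈ map f xs) (ff x) (∈-map⁺ f (from (members e (f x)) (Pf p , q))))

  length-double : ∀ {X : Set} (f : X → X) xs → length (xs ++ map f xs) ≡ 2 * length xs
  length-double f xs = trans (length-++ xs)
    (cong (length xs +_) (trans (length-map f xs) (sym (+-identityʳ (length xs)))))

  -- Admissible pairs of gaps.

  -- The pair (i , j) stands for the gaps q = 1 + i and u = 1 + j.
  Admissible : ℕ → ℕ × ℕ → Set
  Admissible c (i , j) = i ≢ j × 3 + (2 * i + j) < c

  diagonalStep : ℕ × ℕ → ℕ × ℕ
  diagonalStep (i , j) = suc i , suc j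

  secondAxis firstAxis : ℕ → ℕ × ℕ
  secondAxis j = 0 , suc j
  firstAxis    i = suc i , 0

  -- A diagonal step raises `2 * i + j` by 3 and keeps `i ≢ j`, so the pairs with both components
  -- positive come from the bound `c`. The others lie on the axes, without the origin. On the second
  -- axis the bound reads `suc j < c`, that is `j < pred c`; on the first it reads `2 * suc i < c`,
  -- that is `i < ⌊ pred c /2⌋`.
  admissible : ℕ → List (ℕ × ℕ)
  admissible (suc (suc (suc c))) =
    map diagonalStep (admissible c) ++
    map secondAxis (upTo (pred c)) ++ map firstAxis (upTo ⌊ pred c /2⌋)
  admissible _ = []

  pairCount : ℕ → ℕ
  pairCount c = length (admissible c)

  <⌊/2⌋⇒ : ∀ {i} n → i < ⌊ n /2⌋ → 2 * suc i ≤ n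
  <⌊/2⌋⇒ {zero}  (suc (suc n)) _         = s≤s (s≤s z≤n)
  <⌊/2⌋⇒ {suc i} (suc (suc n)) (s≤s i<) =
    subst (_≤ 2 + n) (sym (*-suc 2 (suc i))) (s≤s (s≤s (<⌊/2⌋⇒ n i<)))

  ⇒<⌊/2⌋ : ∀ {i} n → 2 * suc i ≤ n → i < ⌊ n /2⌋
  ⇒<⌊/2⌋ {i} n 2i≤n = subst (_≤ ⌊ n /2⌋) (half (suc i)) (⌊n/2⌋-mono 2i≤n)
    where
    half : ∀ k → ⌊ 2 * k /2⌋ ≡ k
    half k = trans (cong (λ z → ⌊ k + z /2⌋) (+-identityʳ k)) (sym (n≡⌊n+n/2⌋ k))

  ≤pred⇒< : ∀ {m} n → suc m ≤ pred n → suc m < n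
  ≤pred⇒< (suc n) m<n = s≤s m<n

  ∈-admissible⁻ : ∀ c x → x ∈ admissible c → Admissible c x
  ∈-admissible⁻ (suc (suc (suc c))) x x∈
    with ∈-++⁻ (map diagonalStep (admissible c)) x∈
  ... | inj₁ x∈₁ with (i , j) , y∈ , refl ← ∈-map⁻ diagonalStep x∈₁
                    with i≢j , lt ← ∈-admissible⁻ c (i , j) y∈ =
    (i≢j ∘ suc-injective) , subst (_< 3 + c) (shift i j) (s≤s (s≤s (s≤s lt)))
    where
    shift : ∀ i j → 6 + (2 * i + j) ≡ 3 + (2 * suc i + suc j)
    shift = solve-∀
  ... | inj₂ x∈₂ with ∈-++⁻ (map secondAxis (upTo (pred c))) x∈₂
  ...   | inj₁ x∈₃ with j , j∈ , refl ← ∈-map⁻ secondAxis x∈₃ =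
    (λ ()) , s≤s (s≤s (s≤s (≤pred⇒< c (∈-upTo⁻ j∈))))
  ...   | inj₂ x∈₃ with i , i∈ , refl ← ∈-map⁻ firstAxis x∈₃ =
    (λ ()) , s≤s (s≤s (s≤s (subst (_< c) (sym (+-identityʳ (2 * suc i)))
      (≤pred⇒< c (<⌊/2⌋⇒ (pred c) (∈-upTo⁻ i∈))))))

  ∈-admissible⁺ : ∀ c x → Admissible c x → x ∈ admissible c
  ∈-admissible⁺ (suc (suc (suc c))) (zero , zero) (i≢j , _) = contradiction refl i≢j
  ∈-admissible⁺ (suc (suc (suc c))) (zero , suc j) (_ , s≤s (s≤s (s≤s j<))) =
    ∈-++⁺ʳ (map diagonalStep (admissible c)) (∈-++⁺ˡ
      (∈-map⁺ secondAxis (∈-upTo⁺ (<⇒≤pred j<))))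
  ∈-admissible⁺ (suc (suc (suc c))) (suc i , zero) (_ , s≤s (s≤s (s≤s i<))) =
    ∈-++⁺ʳ (map diagonalStep (admissible c)) (∈-++⁺ʳ (map secondAxis (upTo (pred c)))
      (∈-map⁺ firstAxis (∈-upTo⁺ (⇒<⌊/2⌋ (pred c)
        (<⇒≤pred (subst (_< c) (+-identityʳ (2 * suc i)) i<))))))
  ∈-admissible⁺ (suc (suc (suc c))) (suc i , suc j) (i≢j , lt) =
    ∈-++⁺ˡ (∈-map⁺ diagonalStep (∈-admissible⁺ c (i , j)
      ((i≢j ∘ cong suc) , +-cancelˡ-< 3 _ _ (subst (_< 3 + c) (shift i j) lt))))
    where
    shift : ∀ i j → 3 + (2 * suc i + suc j) ≡ 6 + (2 * i + j)
    shift = solve-∀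
  ∈-admissible⁺ (suc zero) _ (_ , s≤s ())
  ∈-admissible⁺ (suc (suc zero)) _ (_ , s≤s (s≤s ()))

  map-disjoint : ∀ {X Y Z : Set} (f : X → Z) (g : Y → Z) {xs ys} → (∀ x y → f x ≢ g y) →
                 Disjoint (map f xs) (map g ys)
  map-disjoint f g f≢g (z∈₁ , z∈₂) =
    let x , _ , z≡fx = ∈-map⁻ f z∈₁
        y , _ , z≡gy = ∈-map⁻ g z∈₂
    in f≢g x y (trans (sym z≡fx) z≡gy)

  admissible-unique : ∀ c → Unique (admissible c)
  admissible-unique (suc (suc (suc c))) =
    Unique.++⁺ (Unique.map⁺ (λ { refl → refl }) (admissible-unique c))
      (Unique.++⁺ (Unique.map⁺ (λ { refl → refl }) (Unique.upTo⁺ _))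
        (Unique.map⁺ (λ { refl → refl }) (Unique.upTo⁺ _))
        (map-disjoint secondAxis firstAxis {upTo (pred c)} λ _ _ ()))
      λ (x∈ , y∈) → [ (λ y∈ → map-disjoint diagonalStep secondAxis (λ _ _ ()) (x∈ , y∈))
                    , (λ y∈ → map-disjoint diagonalStep firstAxis (λ _ _ ()) (x∈ , y∈)) ]′
                    (∈-++⁻ (map secondAxis (upTo (pred c))) y∈)
  admissible-unique zero = []
  admissible-unique (suc zero) = []
  admissible-unique (suc (suc zero)) = []

  -- Recurrences and the closed formula for the number of pairs.

  pairCount-+3 : ∀ c → pairCount (3 + c) ≡ pairCount c + (pred c + ⌊ pred c /2⌋)
  pairCount-+3 c = trans (length-++ (map diagonalStep (admissible c)))
    (cong₂ _+_ (length-map diagonalStep (admissible c))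
      (trans (length-++ (map secondAxis (upTo (pred c))))
        (cong₂ _+_
          (trans (length-map secondAxis (upTo (pred c))) (length-upTo (pred c)))
          (trans (length-map firstAxis (upTo ⌊ pred c /2⌋)) (length-upTo ⌊ pred c /2⌋)))))

  -- Two steps of length 3 have opposite parities, so their halves `⌊ c /2⌋` and `⌈ c /2⌉` add up to
  -- `c` and the increment is linear. The argument `1 + c` keeps `pred` from truncating at 0.
  pairCount-+6 : ∀ c → pairCount (7 + c) ≡ pairCount (1 + c) + (4 + 3 * c)
  pairCount-+6 c = begin
    pairCount (7 + c)                                         ≡⟨ pairCount-+3 (4 + c) ⟩
    pairCount (4 + c) + (3 + c + suc ⌈ c /2⌉)                 ≡⟨ cong (_+ (3 + c + suc ⌈ c /2⌉)) (pairCount-+3 (1 + c)) ⟩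
    pairCount (1 + c) + (c + ⌊ c /2⌋) + (3 + c + suc ⌈ c /2⌉) ≡⟨ regroup (pairCount (1 + c)) c ⌊ c /2⌋ ⌈ c /2⌉ ⟩
    pairCount (1 + c) + (4 + 2 * c + (⌊ c /2⌋ + ⌈ c /2⌉))     ≡⟨ cong (λ z → pairCount (1 + c) + (4 + 2 * c + z)) (⌊n/2⌋+⌈n/2⌉≡n c) ⟩
    pairCount (1 + c) + (4 + 2 * c + c)                       ≡⟨ regroup′ (pairCount (1 + c)) c ⟩
    pairCount (1 + c) + (4 + 3 * c)                           ∎
    where
    open ≡-Reasoning
    regroup : ∀ j c a b → j + (c + a) + (3 + c + suc b) ≡ j + (4 + 2 * c + (a + b))
    regroup = solve-∀
    regroup′ : ∀ j c → j + (4 + 2 * c + c) ≡ j + (4 + 3 * c)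
    regroup′ = solve-∀

  -- This says that `pairCount c` is (3c² - 16c + κ)/12, free of subtraction and division. The
  -- constant `κ` depends on c modulo 6, and 6κ is the constant in the quasi-polynomial for t = 3c.
  PairCountFormula : ℕ → ℕ → Set
  PairCountFormula κ c = 12 * pairCount c + 16 * c ≡ 3 * (c * c) + κ

  -- Passing from `1 + c` to `7 + c` raises both sides of the formula by 144 + 36c, so one value per
  -- residue class modulo 6 settles the class from there on.
  pairCount-closed : ∀ {κ} r k → PairCountFormula κ (1 + r) → PairCountFormula κ (1 + r + k * 6)
  pairCount-closed {κ} r zero    base = subst (PairCountFormula κ) (sym (+-identityʳ (1 + r))) base
  pairCount-closed {κ} r (suc k) base = subst (PairCountFormula κ) (reindex r (k * 6)) (begin
    12 * pairCount (7 + c) + 16 * (7 + c)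
      ≡⟨ cong (λ z → 12 * z + 16 * (7 + c)) (pairCount-+6 c) ⟩
    12 * (pairCount (1 + c) + (4 + 3 * c)) + 16 * (7 + c)
      ≡⟨ regroup (pairCount (1 + c)) c ⟩
    12 * pairCount (1 + c) + 16 * (1 + c) + (144 + 36 * c)
      ≡⟨ cong (_+ (144 + 36 * c)) (pairCount-closed {κ} r k base) ⟩
    3 * ((1 + c) * (1 + c)) + κ + (144 + 36 * c)
      ≡⟨ regroup′ c κ ⟩
    3 * ((7 + c) * (7 + c)) + κ ∎)
    where
    open ≡-Reasoning
    c = r + k * 6
    reindex : ∀ r n → 7 + (r + n) ≡ 1 + r + (6 + n)
    reindex = solve-∀
    regroup : ∀ j c → 12 * (j + (4 + 3 * c)) + 16 * (7 + c) ≡ 12 * j + 16 * (1 + c) + (144 + 36 * c)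
    regroup = solve-∀
    regroup′ : ∀ c κ → 3 * ((1 + c) * (1 + c)) + κ + (144 + 36 * c) ≡ 3 * ((7 + c) * (7 + c)) + κ
    regroup′ = solve-∀

module Squares where

  open Pairs
  open import Defs using (Square; entry; IsMagicSquare; ∈-magicSquares; magicSquares-unique; Mₐ)
  open import Data.Nat.Base
  open import Data.Nat.DivMod using (m*n%n≡0)
  open import Data.Nat.Properties
  open import Data.Nat.Tactic.RingSolver using (solve-∀)
  open import Data.Fin.Base using (Fin; zero; suc; opposite)
  open import Data.Fin using (#_)
  open import Data.Fin.Properties using (all?; opposite-involutive) renaming (_≟_ to _≟ᶠ_; <-cmp to <ᶠ-cmp)
  open import Data.List.Base using (List; []; _∷_; length; map; _++_)
  open import Data.List.Properties using (length-map)
  open import Data.List.Membership.Propositional using (_∈_)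
  open import Data.List.Membership.Propositional.Properties using (∈-map⁺; ∈-map⁻)
  open import Data.List.Relation.Unary.AllPairs using ([])
  import Data.List.Relation.Unary.Unique.Propositional.Properties as Unique
  open import Data.Vec.Base as Vec using (Vec; []; _∷_; lookup; tabulate)
  open import Data.Vec.Properties using (lookup∘tabulate; tabulate∘lookup; lookup-map)
  open import Data.Vec.Relation.Unary.Linked as Linked using (Linked; [-]; _∷_)
  import Data.Vec.Relation.Unary.Linked.Properties as Linked
  open import Data.Product.Base using (∃; ∃₂; _×_; _,_; proj₁; proj₂; swap)
  open import Data.Sum.Base using (_⊎_; inj₁; inj₂)
  open import Function.Base using (_∘_)
  open import Function.Bundles using (mk⇔)
  open import Relation.Binary.Definitions using (tri<; tri≈; tri>)
  open import Relation.Binary.PropositionalEquality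
  open import Relation.Nullary.Decidable using (Dec; from-yes; _×-dec_; _→-dec_)
  open import Relation.Nullary.Negation.Core using (contradiction)

  open IsMagicSquare

  pattern 0F = zero
  pattern 1F = suc zero
  pattern 2F = suc (suc zero)

  -- Reflections of a magic square.

  arrange : (Fin 3 → Fin 3 → ℕ) → Square
  arrange f = tabulate λ i → tabulate (f i)

  entry-arrange : ∀ f i j → entry (arrange f) i j ≡ f i j
  entry-arrange f i j = trans (cong (λ row → lookup row j) (lookup∘tabulate (λ i → tabulate (f i)) i))
    (lookup∘tabulate (f i) j)

  -- Defining `flipRows` by conjugation lets it inherit the preservation of magic squares from the
  -- other two reflections.
  transpose flipColumns flipRows : Square → Square
  transpose   A = arrange λ i j → entry A j i
  flipColumns A = arrange λ i j → entry A i (opposite j)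
  flipRows      = transpose ∘ flipColumns ∘ transpose

  pattern matrix a b c d e f g h i =
    (a ∷ b ∷ c ∷ []) ∷ (d ∷ e ∷ f ∷ []) ∷ (g ∷ h ∷ i ∷ []) ∷ []

  transpose-involutive : ∀ A → transpose (transpose A) ≡ A
  transpose-involutive (matrix _ _ _ _ _ _ _ _ _) = refl

  flipColumns-involutive : ∀ A → flipColumns (flipColumns A) ≡ A
  flipColumns-involutive (matrix _ _ _ _ _ _ _ _ _) = refl

  flipRows-involutive : ∀ A → flipRows (flipRows A) ≡ A
  flipRows-involutive (matrix _ _ _ _ _ _ _ _ _) = refl

  sum-reverse : ∀ x y z → z + (y + (x + 0)) ≡ x + (y + (z + 0))
  sum-reverse = solve-∀

  transpose-magic : ∀ {t A} → IsMagicSquare t A → IsMagicSquare t (transpose A)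
  transpose-magic {t} {A} M = record
    { positive     = λ i j → subst (1 ≤_) (sym (entry-arrange A′ i j)) (positive M j i)
    ; distinct     = λ i j k l eq → swap (distinct M j i l k
        (trans (sym (entry-arrange A′ i j)) (trans eq (entry-arrange A′ k l))))
    ; rowSum       = λ { 0F → columnSum M 0F ; 1F → columnSum M 1F ; 2F → columnSum M 2F }
    ; columnSum    = λ { 0F → columnOf 0F ; 1F → columnOf 1F ; 2F → columnOf 2F }
    ; diagonal     = diagonal M
    ; antidiagonal = trans (sum-reverse (entry A 0F 2F) (entry A 1F 1F) (entry A 2F 0F)) (antidiagonal M)
    }
    where
    A′ : Fin 3 → Fin 3 → ℕ
    A′ i j = entry A j i
    columnOf : ∀ j → Vec.sum (tabulate λ i → entry A j i) ≡ t
    columnOf j = trans (cong Vec.sum (tabulate∘lookup (lookup A j))) (rowSum M j)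

  flipColumns-magic : ∀ {t A} → IsMagicSquare t A → IsMagicSquare t (flipColumns A)
  flipColumns-magic {t} {A@(matrix a b c d e f g h i)} M = record
    { positive     = λ i j → subst (1 ≤_) (sym (entry-arrange A′ i j)) (positive M i (opposite j))
    ; distinct     = λ i j k l eq →
        let i≡k , j≡l = distinct M i (opposite j) k (opposite l)
                          (trans (sym (entry-arrange A′ i j)) (trans eq (entry-arrange A′ k l)))
        in i≡k , trans (sym (opposite-involutive j)) (trans (cong opposite j≡l) (opposite-involutive l))
    ; rowSum       = λ { 0F → trans (sum-reverse a b c) (rowSum M 0F)
                       ; 1F → trans (sum-reverse d e f) (rowSum M 1F)
                       ; 2F → trans (sum-reverse g h i) (rowSum M 2F) }
    ; columnSum    = λ { 0F → columnSum M 2F ; 1F → columnSum M 1F ; 2F → columnSum M 0F }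
    ; diagonal     = antidiagonal M
    ; antidiagonal = diagonal M
    }
    where
    A′ : Fin 3 → Fin 3 → ℕ
    A′ i j = entry A i (opposite j)

  flipRows-magic : ∀ {t A} → IsMagicSquare t A → IsMagicSquare t (flipRows A)
  flipRows-magic M = transpose-magic (flipColumns-magic (transpose-magic M))

  -- Linear relations between the entries.

  record EqualSums (t : ℕ) (A : Square) : Set where
    field
      rowSum       : ∀ i → Vec.sum (lookup A i) ≡ t
      columnSum    : ∀ j → Vec.sum (tabulate λ i → entry A i j) ≡ t
      diagonal     : Vec.sum (tabulate λ i → entry A i i) ≡ t
      antidiagonal : Vec.sum (tabulate λ i → entry A i (opposite i)) ≡ t

  equalSums : ∀ {t A} → IsMagicSquare t A → EqualSums t A
  equalSums M = record { IsMagicSquare M }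

  -- The middle row and the two diagonals together contain the centre three times and each entry of
  -- the two outer columns once, so 3t = 3e + 2t.
  center : ∀ {t A} → EqualSums t A → t ≡ entry A 1F 1F * 3
  center {t} {matrix a b c d e f g h i} S = +-cancelʳ-≡ (t + t) t (e * 3) (begin
    t + (t + t)
      ≡⟨ cong₂ _+_ (EqualSums.rowSum S 1F) (cong₂ _+_ (EqualSums.diagonal S) (EqualSums.antidiagonal S)) ⟨
    (d + (e + (f + 0))) + ((a + (e + (i + 0))) + (c + (e + (g + 0))))
      ≡⟨ regroup a c d e f g i ⟩
    e * 3 + ((a + (d + (g + 0))) + (c + (f + (i + 0))))
      ≡⟨ cong₂ (λ x y → e * 3 + (x + y)) (EqualSums.columnSum S 0F) (EqualSums.columnSum S 2F) ⟩
    e * 3 + (t + t) ∎)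
    where
    open ≡-Reasoning
    regroup : ∀ a c d e f g i →
      (d + (e + (f + 0))) + ((a + (e + (i + 0))) + (c + (e + (g + 0)))) ≡
      e * 3 + ((a + (d + (g + 0))) + (c + (f + (i + 0))))
    regroup = solve-∀

  opposite-corners : ∀ {t A} → EqualSums t A →
                     entry A 0F 0F + entry A 2F 2F ≡ entry A 0F 2F + entry A 2F 0F
  opposite-corners {t} {matrix a b c d e f g h i} S = +-cancelˡ-≡ e (a + i) (c + g) (begin
    e + (a + i)         ≡⟨ regroup a e i ⟨
    a + (e + (i + 0))   ≡⟨ trans (EqualSums.diagonal S) (sym (EqualSums.antidiagonal S)) ⟩
    c + (e + (g + 0))   ≡⟨ regroup c e g ⟩
    e + (c + g)         ∎)
    where
    open ≡-Reasoning
    regroup : ∀ x e y → x + (e + (y + 0)) ≡ e + (x + y)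
    regroup = solve-∀

  cancel₃ : ∀ {t} x y {z z′} → x + (y + (z + 0)) ≡ t → x + (y + (z′ + 0)) ≡ t → z ≡ z′
  cancel₃ x y {z} {z′} eq eq′ = +-cancelʳ-≡ 0 z z′ (+-cancelˡ-≡ y _ _ (+-cancelˡ-≡ x _ _ (trans eq (sym eq′))))

  cancel₂ : ∀ {t} x z {y y′} → x + (y + (z + 0)) ≡ t → x + (y′ + (z + 0)) ≡ t → y ≡ y′
  cancel₂ x z {y} {y′} eq eq′ = +-cancelʳ-≡ (z + 0) y y′ (+-cancelˡ-≡ x _ _ (trans eq (sym eq′)))

  -- The remaining entries follow one by one: the top right from the first row, the centre as a
  -- third of `t`, the lower corners from the diagonals, the left and bottom entries from columns,
  -- the last from the middle row. Assuming only `EqualSums` allows a comparison with a `square`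
  -- whose entries are not yet known to be distinct.
  determined : ∀ {t A B} → EqualSums t A → EqualSums t B →
               entry A 0F 0F ≡ entry B 0F 0F → entry A 0F 1F ≡ entry B 0F 1F → A ≡ B
  determined {A = matrix a b c d e f g h i} {B = matrix _ _ _ d′ e′ _ _ _ _} S T refl refl
    with refl ← cancel₃ a b (EqualSums.rowSum S 0F) (EqualSums.rowSum T 0F)
       | refl ← *-cancelʳ-≡ e e′ 3 (trans (sym (center S)) (center T))
    with refl ← cancel₃ a e (EqualSums.diagonal S) (EqualSums.diagonal T)
       | refl ← cancel₃ c e (EqualSums.antidiagonal S) (EqualSums.antidiagonal T)
    with refl ← cancel₂ a g {d} {d′} (EqualSums.columnSum S 0F) (EqualSums.columnSum T 0F)
       | refl ← cancel₃ b e (EqualSums.columnSum S 1F) (EqualSums.columnSum T 1F)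
    with refl ← cancel₃ d e (EqualSums.rowSum S 1F) (EqualSums.rowSum T 1F) = refl

  -- The family of squares given by the smallest entry and two gaps.

  -- The square with centre m + 2q + u whose corners in decreasing order are
  -- top left, top right, bottom left, bottom right, with successive differences
  -- u, 2q and u.
  square : ℕ → ℕ → ℕ → Square
  square m q u = matrix
    (m + 3 * q + 2 * u) m                   (m + 3 * q + u)
    (m + 2 * q)         (m + 2 * q + u)     (m + 2 * q + 2 * u)
    (m + q + u)         (m + 4 * q + 2 * u) (m + q)

  -- The entry type is left general so that the condition also applies to tables of ranks in
  -- `Fin 9`.
  DistinctEntries : ∀ {X : Set} → Vec (Vec X 3) 3 → Set
  DistinctEntries A = ∀ i j k l → lookup (lookup A i) j ≡ lookup (lookup A k) l → i ≡ k × j ≡ l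

  -- An ascending vector has an injective `lookup`, so distinctness passes from the constant table
  -- `ρ` to the square for all parameter values. For a concrete `ρ` it is decided by evaluation.
  distinct-by-rank : ∀ {v : Vec ℕ 9} (ρ : Vec (Vec (Fin 9) 3) 3) → Linked _<_ v →
                     DistinctEntries ρ → DistinctEntries (Vec.map (Vec.map (lookup v)) ρ)
  distinct-by-rank {v} ρ v↗ ρ-distinct i j k l eq = ρ-distinct i j k l
    (injective _ _ (trans (sym (lookup² i j)) (trans eq (lookup² k l))))
    where
    lookup² : ∀ i j → lookup (lookup (Vec.map (Vec.map (lookup v)) ρ) i) j ≡ lookup v (lookup (lookup ρ i) j)
    lookup² i j = trans (cong (λ row → lookup row j) (lookup-map i (Vec.map (lookup v)) ρ))
      (lookup-map j (lookup v) (lookup ρ i))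
    injective : ∀ x y → lookup v x ≡ lookup v y → x ≡ y
    injective x y eq with <ᶠ-cmp x y
    ... | tri< x<y _ _ = contradiction eq (<⇒≢ (Linked.lookup⁺ <-trans v↗ x<y))
    ... | tri≈ _ x≡y _ = x≡y
    ... | tri> _ _ y<x = contradiction (sym eq) (<⇒≢ (Linked.lookup⁺ <-trans v↗ y<x))

  distinctEntries? : ∀ (ρ : Vec (Vec (Fin 9) 3) 3) → Dec (DistinctEntries ρ)
  distinctEntries? ρ = all? λ i → all? λ j → all? λ k → all? λ l →
    (lookup (lookup ρ i) j ≟ᶠ lookup (lookup ρ k) l) →-dec ((i ≟ᶠ k) ×-dec (j ≟ᶠ l))

  <-gap : ∀ x {g y} → 1 ≤ g → x + g ≡ y → x < y
  <-gap x 1≤g refl = m<m+n x 1≤g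

  -- The entries of square m q u in increasing order, for q < u and for u < q.
  wide narrow : ℕ → ℕ → ℕ → Vec ℕ 9
  wide m q u =
    m ∷ m + q ∷ m + 2 * q ∷ m + q + u ∷ m + 2 * q + u ∷ m + 3 * q + u ∷
    m + 2 * q + 2 * u ∷ m + 3 * q + 2 * u ∷ m + 4 * q + 2 * u ∷ []
  narrow m q u =
    m ∷ m + q ∷ m + q + u ∷ m + 2 * q ∷ m + 2 * q + u ∷ m + 2 * q + 2 * u ∷
    m + 3 * q + u ∷ m + 3 * q + 2 * u ∷ m + 4 * q + 2 * u ∷ []

  -- With `u` written as `q + w`, the successive gaps are q, q, w, q, q, w, q, q.
  wide-ascending : ∀ m q w → 1 ≤ q → 1 ≤ w → Linked _<_ (wide m q (q + w))
  wide-ascending m q w 1≤q 1≤w =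
      <-gap m 1≤q refl
    ∷ <-gap (m + q) 1≤q (gap₁ m q w)
    ∷ <-gap (m + 2 * q) 1≤w (gap₂ m q w)
    ∷ <-gap (m + q + (q + w)) 1≤q (gap₃ m q w)
    ∷ <-gap (m + 2 * q + (q + w)) 1≤q (gap₄ m q w)
    ∷ <-gap (m + 3 * q + (q + w)) 1≤w (gap₅ m q w)
    ∷ <-gap (m + 2 * q + 2 * (q + w)) 1≤q (gap₆ m q w)
    ∷ <-gap (m + 3 * q + 2 * (q + w)) 1≤q (gap₇ m q w)
    ∷ [-]
    where
    gap₁ : ∀ m q w → m + q + q ≡ m + 2 * q
    gap₁ = solve-∀
    gap₂ : ∀ m q w → m + 2 * q + w ≡ m + q + (q + w)
    gap₂ = solve-∀
    gap₃ : ∀ m q w → m + q + (q + w) + q ≡ m + 2 * q + (q + w)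
    gap₃ = solve-∀
    gap₄ : ∀ m q w → m + 2 * q + (q + w) + q ≡ m + 3 * q + (q + w)
    gap₄ = solve-∀
    gap₅ : ∀ m q w → m + 3 * q + (q + w) + w ≡ m + 2 * q + 2 * (q + w)
    gap₅ = solve-∀
    gap₆ : ∀ m q w → m + 2 * q + 2 * (q + w) + q ≡ m + 3 * q + 2 * (q + w)
    gap₆ = solve-∀
    gap₇ : ∀ m q w → m + 3 * q + 2 * (q + w) + q ≡ m + 4 * q + 2 * (q + w)
    gap₇ = solve-∀

  -- With `q` written as `u + w`, the successive gaps are q, u, w, u, u, w, u, q.
  narrow-ascending : ∀ m u w → 1 ≤ u → 1 ≤ w → Linked _<_ (narrow m (u + w) u)
  narrow-ascending m u w 1≤u 1≤w =
      <-gap m 1≤u+w refl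
    ∷ <-gap (m + (u + w)) 1≤u refl
    ∷ <-gap (m + (u + w) + u) 1≤w (gap₁ m u w)
    ∷ <-gap (m + 2 * (u + w)) 1≤u refl
    ∷ <-gap (m + 2 * (u + w) + u) 1≤u (gap₂ m u w)
    ∷ <-gap (m + 2 * (u + w) + 2 * u) 1≤w (gap₃ m u w)
    ∷ <-gap (m + 3 * (u + w) + u) 1≤u (gap₄ m u w)
    ∷ <-gap (m + 3 * (u + w) + 2 * u) 1≤u+w (gap₅ m u w)
    ∷ [-]
    where
    1≤u+w = ≤-trans 1≤u (m≤m+n u w)
    gap₁ : ∀ m u w → m + (u + w) + u + w ≡ m + 2 * (u + w)
    gap₁ = solve-∀
    gap₂ : ∀ m u w → m + 2 * (u + w) + u + u ≡ m + 2 * (u + w) + 2 * u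
    gap₂ = solve-∀
    gap₃ : ∀ m u w → m + 2 * (u + w) + 2 * u + w ≡ m + 3 * (u + w) + u
    gap₃ = solve-∀
    gap₄ : ∀ m u w → m + 3 * (u + w) + u + u ≡ m + 3 * (u + w) + 2 * u
    gap₄ = solve-∀
    gap₅ : ∀ m u w → m + 3 * (u + w) + 2 * u + (u + w) ≡ m + 4 * (u + w) + 2 * u
    gap₅ = solve-∀

  -- Looking these positions up in `wide m q u` or `narrow m q u` evaluates to `square m q u`. The
  -- two orders differ by exchanging ranks 2 with 3 and 5 with 6.
  wideRanks narrowRanks : Vec (Vec (Fin 9) 3) 3
  wideRanks = matrix
    (# 7) (# 0) (# 5)
    (# 2) (# 4) (# 6)
    (# 3) (# 8) (# 1)
  narrowRanks = matrix
    (# 7) (# 0) (# 6)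
    (# 3) (# 4) (# 5)
    (# 2) (# 8) (# 1)

  square-distinct : ∀ m q u → 1 ≤ q → 1 ≤ u → q ≢ u → DistinctEntries (square m q u)
  square-distinct m q u 1≤q 1≤u q≢u with <-cmp q u
  ... | tri≈ _ q≡u _ = contradiction q≡u q≢u
  ... | tri< q<u _ _ = distinct-by-rank {wide m q u} wideRanks
    (subst (Linked _<_ ∘ wide m q) (m+[n∸m]≡n (<⇒≤ q<u))
      (wide-ascending m q (u ∸ q) 1≤q (m<n⇒0<n∸m q<u)))
    (from-yes (distinctEntries? wideRanks))
  ... | tri> _ _ u<q = distinct-by-rank {narrow m q u} narrowRanks
    (subst (λ q → Linked _<_ (narrow m q u)) (m+[n∸m]≡n (<⇒≤ u<q))
      (narrow-ascending m u (q ∸ u) 1≤u (m<n⇒0<n∸m u<q)))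
    (from-yes (distinctEntries? narrowRanks))

  square-sums : ∀ m q u → EqualSums ((m + 2 * q + u) * 3) (square m q u)
  square-sums m q u = record
    { rowSum       = λ { 0F → row₀ m q u ; 1F → row₁ m q u ; 2F → row₂ m q u }
    ; columnSum    = λ { 0F → column₀ m q u ; 1F → column₁ m q u ; 2F → column₂ m q u }
    ; diagonal     = diagonal′ m q u
    ; antidiagonal = antidiagonal′ m q u
    }
    where
    row₀ : ∀ m q u → (m + 3 * q + 2 * u) + (m + ((m + 3 * q + u) + 0)) ≡ (m + 2 * q + u) * 3
    row₀ = solve-∀
    row₁ : ∀ m q u → (m + 2 * q) + ((m + 2 * q + u) + ((m + 2 * q + 2 * u) + 0)) ≡ (m + 2 * q + u) * 3
    row₁ = solve-∀
    row₂ : ∀ m q u → (m + q + u) + ((m + 4 * q + 2 * u) + ((m + q) + 0)) ≡ (m + 2 * q + u) * 3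
    row₂ = solve-∀
    column₀ : ∀ m q u → (m + 3 * q + 2 * u) + ((m + 2 * q) + ((m + q + u) + 0)) ≡ (m + 2 * q + u) * 3
    column₀ = solve-∀
    column₁ : ∀ m q u → m + ((m + 2 * q + u) + ((m + 4 * q + 2 * u) + 0)) ≡ (m + 2 * q + u) * 3
    column₁ = solve-∀
    column₂ : ∀ m q u → (m + 3 * q + u) + ((m + 2 * q + 2 * u) + ((m + q) + 0)) ≡ (m + 2 * q + u) * 3
    column₂ = solve-∀
    diagonal′ : ∀ m q u → (m + 3 * q + 2 * u) + ((m + 2 * q + u) + ((m + q) + 0)) ≡ (m + 2 * q + u) * 3
    diagonal′ = solve-∀
    antidiagonal′ : ∀ m q u → (m + 3 * q + u) + ((m + 2 * q + u) + ((m + q + u) + 0)) ≡ (m + 2 * q + u) * 3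
    antidiagonal′ = solve-∀

  square-magic : ∀ m q u → 1 ≤ m → 1 ≤ q → 1 ≤ u → q ≢ u →
                 IsMagicSquare ((m + 2 * q + u) * 3) (square m q u)
  square-magic m q u 1≤m 1≤q 1≤u q≢u = record
    { positive = λ
        { 0F 0F → m≤ (m≤ 1≤m) ; 0F 1F → 1≤m         ; 0F 2F → m≤ (m≤ 1≤m)
        ; 1F 0F → m≤ 1≤m      ; 1F 1F → m≤ (m≤ 1≤m) ; 1F 2F → m≤ (m≤ 1≤m)
        ; 2F 0F → m≤ (m≤ 1≤m) ; 2F 1F → m≤ (m≤ 1≤m) ; 2F 2F → m≤ 1≤m }
    ; distinct = square-distinct m q u 1≤q 1≤u q≢u
    ; EqualSums (square-sums m q u)
    }
    where
    m≤ : ∀ {x y} → 1 ≤ x → 1 ≤ x + y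
    m≤ 1≤x = ≤-trans 1≤x (m≤m+n _ _)

  -- Normal forms under the eight symmetries.

  LeftHeavy TopHeavy Ordered : Square → Set
  LeftHeavy A = entry A 0F 2F < entry A 0F 0F
  TopHeavy  A = entry A 2F 0F < entry A 0F 0F
  Ordered   A = entry A 2F 0F < entry A 0F 2F

  corners-center : ∀ {t A} → EqualSums t A → entry A 0F 2F + entry A 2F 0F ≡ entry A 1F 1F + entry A 1F 1F
  corners-center {t} {matrix a b c d e f g h k} S = +-cancelˡ-≡ e (c + g) (e + e) (begin
    e + (c + g)        ≡⟨ regroup c e g ⟩
    c + (e + (g + 0))  ≡⟨ trans (EqualSums.antidiagonal S) (center S) ⟩
    e * 3              ≡⟨ triple e ⟩
    e + (e + e)        ∎)
    where
    open ≡-Reasoning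
    regroup : ∀ x e y → e + (x + y) ≡ x + (e + (y + 0))
    regroup = solve-∀
    triple : ∀ e → e * 3 ≡ e + (e + e)
    triple = solve-∀

  -- The two antidiagonal corners average to the centre, so the larger one exceeds it.
  center<corner : ∀ {t A} → EqualSums t A → Ordered A → entry A 1F 1F < entry A 0F 2F
  center<corner S g<c = ≰⇒> λ c≤e →
    <⇒≢ (+-mono-≤-< c≤e (<-≤-trans g<c c≤e)) (corners-center S)

  -- The gaps are q = c - e and u = a - c, where e is the centre and a, c are the top corners. As
  -- the first row sums to 3e, the top middle entry is e - 2q - u. The first two entries then agree
  -- with those of `square`, and `determined` gives the rest.
  normal-form : ∀ {t A} → EqualSums t A → LeftHeavy A → Ordered A → ∃₂ λ i j →
                A ≡ square (entry A 0F 1F) (suc i) (suc j) ×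
                entry A 1F 1F ≡ entry A 0F 1F + 2 * suc i + suc j
  normal-form {t} {A@(matrix a b c d e f g h k)} S c<a g<c =
    i , j , determined S square-S a≡ refl , e≡
    where
    -- These are q - 1 and u - 1; nothing is truncated because e < c and c < a.
    i = c ∸ suc e
    j = a ∸ suc c
    c≡ : e + suc i ≡ c
    c≡ = trans (+-suc e i) (m+[n∸m]≡n (center<corner S g<c))
    a≡c+ : c + suc j ≡ a
    a≡c+ = trans (+-suc c j) (m+[n∸m]≡n c<a)
    regroup : ∀ e b q u → e + e + (b + 2 * q + u) ≡ e + q + u + (b + (e + q + 0))
    regroup = solve-∀
    triple : ∀ e → e * 3 ≡ e + e + e
    triple = solve-∀
    corner : ∀ m q u → m + 2 * q + u + q + u ≡ m + 3 * q + 2 * u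
    corner = solve-∀
    e≡ : e ≡ b + 2 * suc i + suc j
    e≡ = +-cancelˡ-≡ (e + e) _ _ (begin
      e + e + e                                     ≡⟨ triple e ⟨
      e * 3                                         ≡⟨ center S ⟨
      t                                             ≡⟨ EqualSums.rowSum S 0F ⟨
      a + (b + (c + 0))                             ≡⟨ cong (λ z → z + (b + (c + 0))) a≡c+ ⟨
      c + suc j + (b + (c + 0))                     ≡⟨ cong (λ z → z + suc j + (b + (z + 0))) c≡ ⟨
      e + suc i + suc j + (b + (e + suc i + 0))     ≡⟨ regroup e b (suc i) (suc j) ⟨
      e + e + (b + 2 * suc i + suc j)               ∎)
      where open ≡-Reasoning
    a≡ : a ≡ b + 3 * suc i + 2 * suc j
    a≡ = begin
      a                                            ≡⟨ a≡c+ ⟨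
      c + suc j                                    ≡⟨ cong (_+ suc j) c≡ ⟨
      e + suc i + suc j                            ≡⟨ cong (λ z → z + suc i + suc j) e≡ ⟩
      b + 2 * suc i + suc j + suc i + suc j        ≡⟨ corner b (suc i) (suc j) ⟩
      b + 3 * suc i + 2 * suc j                    ∎
      where open ≡-Reasoning
    square-S : EqualSums t (square b (suc i) (suc j))
    square-S = subst (λ t → EqualSums t (square b (suc i) (suc j)))
      (sym (trans (center S) (cong (_* 3) e≡))) (square-sums b (suc i) (suc j))

  -- On admissible pairs the subtraction does not truncate.
  squareAt : ℕ → ℕ × ℕ → Square
  squareAt c (i , j) = square (c ∸ (2 * suc i + suc j)) (suc i) (suc j)

  -- The top middle entry gives m, the middle left entry m + 2q then gives q, and the centre gives
  -- u.
  squareAt-injective : ∀ {c x y} → squareAt c x ≡ squareAt c y → x ≡ y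
  squareAt-injective {c} {i , j} {i′ , j′} eq = cong₂ _,_ (suc-injective q≡q′) (suc-injective u≡u′)
    where
    m  = c ∸ (2 * suc i + suc j)
    m≡m′ : m ≡ c ∸ (2 * suc i′ + suc j′)
    m≡m′ = cong (λ A → entry A 0F 1F) eq
    q≡q′ : suc i ≡ suc i′
    q≡q′ = *-cancelˡ-≡ (suc i) (suc i′) 2 (+-cancelˡ-≡ m _ _
      (trans (cong (λ A → entry A 1F 0F) eq) (cong (_+ 2 * suc i′) (sym m≡m′))))
    u≡u′ : suc j ≡ suc j′
    u≡u′ = +-cancelˡ-≡ (m + 2 * suc i) _ _
      (trans (cong (λ A → entry A 1F 1F) eq)
        (cong₂ (λ m q → m + 2 * q + suc j′) (sym m≡m′) (sym q≡q′)))

  -- The nesting follows the successive uses of `++-involution`: `Ordered` is the choice made for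
  -- `transpose`, `TopHeavy` for `flipRows` and `LeftHeavy` for `flipColumns`.
  Normal : ℕ → Square → Set
  Normal c A = ((IsMagicSquare (c * 3) A × LeftHeavy A) × TopHeavy A) × Ordered A

  gaps : ∀ i j → 3 + (2 * i + j) ≡ 2 * suc i + suc j
  gaps = solve-∀

  squareAt-normal : ∀ c x → Admissible c x → Normal c (squareAt c x)
  squareAt-normal c x@(i , j) (i≢j , lt) =
    ((subst (λ c′ → IsMagicSquare (c′ * 3) (squareAt c x))
        (trans (+-assoc m (2 * suc i) (suc j)) (m∸n+n≡m (<⇒≤ lt′)))
        (square-magic m (suc i) (suc j) (m<n⇒0<n∸m lt′) (s≤s z≤n) (s≤s z≤n) (i≢j ∘ suc-injective))
      , <-gap _ {suc j} (s≤s z≤n) (left m (suc i) (suc j)))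
      , <-gap _ {2 * suc i + suc j} (s≤s z≤n) (top m (suc i) (suc j)))
      , <-gap _ {2 * suc i} (s≤s z≤n) (ordered m (suc i) (suc j))
    where
    m = c ∸ (2 * suc i + suc j)
    lt′ : 2 * suc i + suc j < c
    lt′ = subst (_< c) (gaps i j) lt
    left : ∀ m q u → m + 3 * q + u + u ≡ m + 3 * q + 2 * u
    left = solve-∀
    top : ∀ m q u → m + q + u + (2 * q + u) ≡ m + 3 * q + 2 * u
    top = solve-∀
    ordered : ∀ m q u → m + q + u + 2 * q ≡ m + 3 * q + u
    ordered = solve-∀

  normal-squareAt : ∀ c A → Normal c A → ∃ λ x → Admissible c x × A ≡ squareAt c x
  normal-squareAt c A@(matrix a b _ d e _ g _ _) (((M , left) , _) , ordered)
    with i , j , A≡ , e≡ ← normal-form (equalSums M) left ordered =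
    (i , j) , (i≢j , lt) ,
    trans A≡ (cong (λ m → square m (suc i) (suc j)) (sym (trans (cong (_∸ (2 * suc i + suc j)) c≡) (m+n∸n≡m b (2 * suc i + suc j)))))
    where
    c≡ : c ≡ b + (2 * suc i + suc j)
    c≡ = trans (*-cancelʳ-≡ c e 3 (center (equalSums M))) (trans e≡ (+-assoc b (2 * suc i) (suc j)))
    -- The difference between c and 2q + u is the top middle entry, which is positive.
    lt : 3 + (2 * i + j) < c
    lt = subst₂ _<_ (sym (gaps i j)) (trans (+-comm (2 * suc i + suc j) b) (sym c≡))
      (m<m+n (2 * suc i + suc j) (positive M 0F 1F))
    d≡g : ∀ m q → m + 2 * q ≡ m + q + q
    d≡g = solve-∀
    -- If q = u, the middle left entry m + 2q equals the bottom left entry m + q + u.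
    i≢j : i ≢ j
    i≢j refl with () ← proj₁ (distinct M 1F 0F 2F 0F
      (trans (cong (λ A → entry A 1F 0F) A≡)
        (trans (d≡g b (suc i)) (sym (cong (λ A → entry A 2F 0F) A≡)))))

  normal-squares : ∀ c → Enumerates (map (squareAt c) (admissible c)) (Normal c)
  normal-squares c = enumerates (Unique.map⁺ (squareAt-injective {c}) (admissible-unique c))
    λ A → mk⇔
      (λ A∈ → let x , x∈ , eq = ∈-map⁻ (squareAt c) A∈
              in subst (Normal c) (sym eq) (squareAt-normal c x (∈-admissible⁻ c x x∈)))
      (λ N → let x , adm , eq = normal-squareAt c A N
             in subst (_∈ map (squareAt c) (admissible c)) (sym eq)
                  (∈-map⁺ (squareAt c) (∈-admissible⁺ c x adm)))

  -- The eightfold count.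

  double : List Square → (Square → Square) → List Square
  double As f = As ++ map f As

  -- Each reflection must respect the choices imposed further out: `transpose` exchanges `LeftHeavy`
  -- and `TopHeavy`, and `flipRows` keeps `LeftHeavy`. Ties between corners are excluded by
  -- distinctness.
  magic-squares : ∀ c → Enumerates
    (double (double (double (map (squareAt c) (admissible c)) transpose) flipRows) flipColumns)
    (IsMagicSquare (c * 3))
  magic-squares c =
    ++-involution flipColumns-involutive flipColumns-magic <-asym leftOrFlip
    (++-involution flipRows-involutive flipRows-left <-asym topOrFlip
    (++-involution transpose-involutive (λ ((M , l) , t) → (transpose-magic M , t) , l) <-asym orderedOrTranspose
    (normal-squares c)))
    where
    leftOrFlip : ∀ {A} → IsMagicSquare (c * 3) A → LeftHeavy A ⊎ LeftHeavy (flipColumns A)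
    leftOrFlip {A} M with <-cmp (entry A 0F 2F) (entry A 0F 0F)
    ... | tri< lt _ _ = inj₁ lt
    ... | tri≈ _ eq _ with () ← proj₂ (distinct M 0F 2F 0F 0F eq)
    ... | tri> _ _ gt = inj₂ gt
    topOrFlip : ∀ {A} → IsMagicSquare (c * 3) A × LeftHeavy A → TopHeavy A ⊎ TopHeavy (flipRows A)
    topOrFlip {A} (M , _) with <-cmp (entry A 2F 0F) (entry A 0F 0F)
    ... | tri< lt _ _ = inj₁ lt
    ... | tri≈ _ eq _ with () ← proj₁ (distinct M 2F 0F 0F 0F eq)
    ... | tri> _ _ gt = inj₂ gt
    orderedOrTranspose : ∀ {A} → (IsMagicSquare (c * 3) A × LeftHeavy A) × TopHeavy A →
                         Ordered A ⊎ Ordered (transpose A)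
    orderedOrTranspose {A} ((M , _) , _) with <-cmp (entry A 2F 0F) (entry A 0F 2F)
    ... | tri< lt _ _ = inj₁ lt
    ... | tri≈ _ eq _ with () ← proj₁ (distinct M 2F 0F 0F 2F eq)
    ... | tri> _ _ gt = inj₂ gt
    -- After the flip the condition concerns the bottom corners. Opposite corners have equal sums, a
    -- + i = c + g, so c < a forces i < g.
    flipRows-left : ∀ {A} → IsMagicSquare (c * 3) A × LeftHeavy A →
                    IsMagicSquare (c * 3) (flipRows A) × LeftHeavy (flipRows A)
    flipRows-left {A@(matrix a _ c _ _ _ g _ i)} (M , c<a) = flipRows-magic M ,
      ≰⇒> λ g≤i → <⇒≢ (+-mono-<-≤ c<a g≤i) (sym (opposite-corners (equalSums M)))

  Mₐ-triple : ∀ c → Mₐ (c * 3) ≡ 8 * pairCount c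
  Mₐ-triple c = begin
    Mₐ (c * 3)                                   ≡⟨ length-unique (enumerates (magicSquares-unique (c * 3)) (∈-magicSquares (c * 3))) (magic-squares c) ⟩
    length (double (double (double N transpose) flipRows) flipColumns)
                                                 ≡⟨ length-double flipColumns (double (double N transpose) flipRows) ⟩
    2 * length (double (double N transpose) flipRows)
                                                 ≡⟨ cong (2 *_) (length-double flipRows (double N transpose)) ⟩
    2 * (2 * length (double N transpose))        ≡⟨ cong (λ n → 2 * (2 * n)) (length-double transpose N) ⟩
    2 * (2 * (2 * length N))                     ≡⟨ cong (λ n → 2 * (2 * (2 * n))) (length-map (squareAt c) (admissible c)) ⟩
    2 * (2 * (2 * pairCount c))                  ≡⟨ regroup (pairCount c) ⟩
    8 * pairCount c                              ∎
    where
    open ≡-Reasoning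
    N = map (squareAt c) (admissible c)
    regroup : ∀ n → 2 * (2 * (2 * n)) ≡ 8 * n
    regroup = solve-∀

  -- The sum is three times the centre, so for other `t` the empty list is a complete enumeration.
  Mₐ-nontriple : ∀ t → t % 3 ≢ 0 → Mₐ t ≡ 0
  Mₐ-nontriple t t%3≢0 = length-unique
    (enumerates (magicSquares-unique t) (∈-magicSquares t))
    (enumerates [] λ A → mk⇔ (λ ()) λ M → contradiction
      (trans (cong (_% 3) (center (equalSums M))) (m*n%n≡0 (entry A 1F 1F) 3)) t%3≢0)

open import Defs using (Mₐ; quad; module PowerSeries)
open import Data.Nat.Base as ℕ using (ℕ; zero; suc; _≤_; _%_)
import Data.Nat.DivMod as ℕ
import Data.Nat.Properties as ℕ
import Data.Nat.Tactic.RingSolver as ℕ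
open import Data.Integer.Base as ℤ using (ℤ; +_; 0ℤ; 1ℤ)
import Data.Integer.Properties as ℤ
import Data.Integer.Tactic.RingSolver as ℤ
open import Data.Rational.Base using (_/_)
open import Data.Rational.Properties using (fromℚᵘ-cong)
open import Data.Rational.Unnormalised.Base using (mkℚᵘ; *≡*)
open import Data.Product.Base using (_×_; _,_)
open import Function.Base using (_∘_)
open import Relation.Nullary.Negation.Core using (¬_; contradiction)
open import Relation.Binary.PropositionalEquality using (_≡_; _≗_; refl; sym; trans; cong; cong₂; subst; module ≡-Reasoning)
open Pairs using (pairCount; pairCount-+3; PairCountFormula; pairCount-closed)
open Squares using (Mₐ-triple; Mₐ-nontriple)
open PowerSeries using (∑₊; _+_; _-_; _*_; _•_; x^_; 1#; _/_[_])
open PowerSeries using (Series; /-unique)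

-- Products with polynomials as shifts and differences.

shift : Series → Series
shift f zero    = 0ℤ
shift f (suc n) = f n

shiftBy : ℕ → Series → Series
shiftBy zero    f = f
shiftBy (suc k) f = shift (shiftBy k f)

shift-cong : ∀ {f g} → f ≗ g → shift f ≗ shift g
shift-cong f≗g zero    = refl
shift-cong f≗g (suc n) = f≗g n

-- The inductions on coefficients rest on the fact that `(f * g) (suc n)` unfolds to
-- `f 0 ℤ.* g (suc n)` plus the coefficient `n` of `(f ∘ suc) * g`; hence `f` varies in the
-- recursive calls.
*-congˡ : ∀ f {g h} → g ≗ h → f * g ≗ f * h
*-congˡ f g≗h zero    = cong (λ z → f 0 ℤ.* z ℤ.+ 0ℤ) (g≗h 0)
*-congˡ f g≗h (suc n) = cong₂ (λ x y → f 0 ℤ.* x ℤ.+ y) (g≗h (suc n)) (*-congˡ (f ∘ suc) g≗h n)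

*-identityʳ : ∀ f → f * 1# ≗ f
*-identityʳ f zero    = lemma (f 0)
  where
  lemma : ∀ x → x ℤ.* 1ℤ ℤ.+ 0ℤ ≡ x
  lemma = ℤ.solve-∀
*-identityʳ f (suc n) = trans (cong₂ ℤ._+_ (ℤ.*-zeroʳ (f 0)) (*-identityʳ (f ∘ suc) n))
  (ℤ.+-identityˡ (f (suc n)))

*-shift : ∀ f g → f * shift g ≗ shift (f * g)
*-shift f g zero          = cong (ℤ._+ 0ℤ) (ℤ.*-zeroʳ (f 0))
*-shift f g (suc zero)    = cong (λ z → f 0 ℤ.* g 0 ℤ.+ z) (*-shift (f ∘ suc) g zero)
*-shift f g (suc (suc n)) = cong (λ z → f 0 ℤ.* g (suc n) ℤ.+ z) (*-shift (f ∘ suc) g (suc n))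

*-shiftBy : ∀ k f g → f * shiftBy k g ≗ shiftBy k (f * g)
*-shiftBy zero    f g n = refl
*-shiftBy (suc k) f g n = trans (*-shift f (shiftBy k g) n) (shift-cong (*-shiftBy k f g) n)

*-distribˡ-+ : ∀ f g h → f * (g + h) ≗ (f * g) + (f * h)
*-distribˡ-+ f g h zero    = lemma (f 0) (g 0) (h 0)
  where
  lemma : ∀ x y z → x ℤ.* (y ℤ.+ z) ℤ.+ 0ℤ ≡ (x ℤ.* y ℤ.+ 0ℤ) ℤ.+ (x ℤ.* z ℤ.+ 0ℤ)
  lemma = ℤ.solve-∀
*-distribˡ-+ f g h (suc n) =
  trans (cong (λ z → f 0 ℤ.* (g (suc n) ℤ.+ h (suc n)) ℤ.+ z) (*-distribˡ-+ (f ∘ suc) g h n))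
    (lemma (f 0) (g (suc n)) (h (suc n)) (((f ∘ suc) * g) n) (((f ∘ suc) * h) n))
  where
  lemma : ∀ x y z u v → x ℤ.* (y ℤ.+ z) ℤ.+ (u ℤ.+ v) ≡ (x ℤ.* y ℤ.+ u) ℤ.+ (x ℤ.* z ℤ.+ v)
  lemma = ℤ.solve-∀

*-• : ∀ c f g → f * (c • g) ≗ c • (f * g)
*-• c f g zero    = lemma c (f 0) (g 0)
  where
  lemma : ∀ c x y → x ℤ.* (c ℤ.* y) ℤ.+ 0ℤ ≡ c ℤ.* (x ℤ.* y ℤ.+ 0ℤ)
  lemma = ℤ.solve-∀
*-• c f g (suc n) =
  trans (cong (λ z → f 0 ℤ.* (c ℤ.* g (suc n)) ℤ.+ z) (*-• c (f ∘ suc) g n))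
    (lemma c (f 0) (g (suc n)) (((f ∘ suc) * g) n))
  where
  lemma : ∀ c x y z → x ℤ.* (c ℤ.* y) ℤ.+ c ℤ.* z ≡ c ℤ.* (x ℤ.* y ℤ.+ z)
  lemma = ℤ.solve-∀

x^-shiftBy : ∀ k → x^ k ≗ shiftBy k 1#
x^-shiftBy zero    n       = refl
x^-shiftBy (suc k) zero    = refl
x^-shiftBy (suc k) (suc n) = x^-shiftBy k n

shiftBy-cong : ∀ k {f g} → f ≗ g → shiftBy k f ≗ shiftBy k g
shiftBy-cong zero    f≗g = f≗g
shiftBy-cong (suc k) f≗g = shift-cong (shiftBy-cong k f≗g)

*-x^ : ∀ f k → f * x^ k ≗ shiftBy k f
*-x^ f k n = trans (*-congˡ f (x^-shiftBy k) n)
  (trans (*-shiftBy k f 1# n) (shiftBy-cong k (*-identityʳ f) n))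

-- This is multiplication by 1 - x^k, as `*-1-x^` shows.
Δ : ℕ → Series → Series
Δ k f = f - shiftBy k f

Δ-cong : ∀ k {f g} → f ≗ g → Δ k f ≗ Δ k g
Δ-cong k f≗g n = cong₂ ℤ._-_ (f≗g n) (shiftBy-cong k f≗g n)

*-distribˡ-- : ∀ f g h → f * (g - h) ≗ (f * g) - (f * h)
*-distribˡ-- f g h zero    = lemma (f 0) (g 0) (h 0)
  where
  lemma : ∀ x y z → x ℤ.* (y ℤ.- z) ℤ.+ 0ℤ ≡ (x ℤ.* y ℤ.+ 0ℤ) ℤ.- (x ℤ.* z ℤ.+ 0ℤ)
  lemma = ℤ.solve-∀
*-distribˡ-- f g h (suc n) =
  trans (cong (λ z → f 0 ℤ.* (g (suc n) ℤ.- h (suc n)) ℤ.+ z) (*-distribˡ-- (f ∘ suc) g h n))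
    (lemma (f 0) (g (suc n)) (h (suc n)) (((f ∘ suc) * g) n) (((f ∘ suc) * h) n))
  where
  lemma : ∀ x y z u v → x ℤ.* (y ℤ.- z) ℤ.+ (u ℤ.- v) ≡ (x ℤ.* y ℤ.+ u) ℤ.- (x ℤ.* z ℤ.+ v)
  lemma = ℤ.solve-∀

*-Δ : ∀ k f g → f * Δ k g ≗ Δ k (f * g)
*-Δ k f g n = trans (*-distribˡ-- f g (shiftBy k g) n)
  (cong (λ z → (f * g) n ℤ.- z) (*-shiftBy k f g n))

*-1-x^ : ∀ k f → f * (1# - x^ k) ≗ Δ k f
*-1-x^ k f n = trans (*-distribˡ-- f 1# (x^ k) n) (cong₂ ℤ._-_ (*-identityʳ f n) (*-x^ f k n))

-- The factors are peeled off from the right, each turning into a difference operator that moves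
-- outside the product.
*-denominator : ∀ f i j k → f * ((1# - x^ i) * (1# - x^ j) * (1# - x^ k)) ≗ Δ k (Δ j (Δ i f))
*-denominator f i j k n = begin
  (f * (g * h * (1# - x^ k))) n  ≡⟨ *-congˡ f (*-1-x^ k (g * h)) n ⟩
  (f * Δ k (g * h)) n            ≡⟨ *-Δ k f (g * h) n ⟩
  Δ k (f * (g * h)) n            ≡⟨ Δ-cong k (*-congˡ f (*-1-x^ j g)) n ⟩
  Δ k (f * Δ j g) n              ≡⟨ Δ-cong k (*-Δ j f g) n ⟩
  Δ k (Δ j (f * g)) n            ≡⟨ Δ-cong k (Δ-cong j (*-1-x^ i f)) n ⟩
  Δ k (Δ j (Δ i f)) n            ∎
  where
  open ≡-Reasoning
  g h : Series
  g = 1# - x^ i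
  h = 1# - x^ j

-- Series in x³.

-- f(x³)
spread : Series → Series
spread f zero                = f 0
spread f (suc zero)          = 0ℤ
spread f (suc (suc zero))    = 0ℤ
spread f (suc (suc (suc n))) = spread (f ∘ suc) n

spread-cong : ∀ {f g} → f ≗ g → spread f ≗ spread g
spread-cong f≗g zero                = f≗g 0
spread-cong f≗g (suc zero)          = refl
spread-cong f≗g (suc (suc zero))    = refl
spread-cong f≗g (suc (suc (suc n))) = spread-cong (f≗g ∘ suc) n

shiftBy-3-spread : ∀ f → shiftBy 3 (spread f) ≗ spread (shift f)
shiftBy-3-spread f zero                = refl
shiftBy-3-spread f (suc zero)          = refl
shiftBy-3-spread f (suc (suc zero))    = refl
shiftBy-3-spread f (suc (suc (suc n))) = refl

shiftBy-spread : ∀ k f → shiftBy (k ℕ.* 3) (spread f) ≗ spread (shiftBy k f)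
shiftBy-spread zero    f n = refl
shiftBy-spread (suc k) f n = trans (shiftBy-cong 3 (shiftBy-spread k f) n) (shiftBy-3-spread (shiftBy k f) n)

spread-+ : ∀ f g → spread (f + g) ≗ spread f + spread g
spread-+ f g zero                = refl
spread-+ f g (suc zero)          = refl
spread-+ f g (suc (suc zero))    = refl
spread-+ f g (suc (suc (suc n))) = spread-+ (f ∘ suc) (g ∘ suc) n

spread-- : ∀ f g → spread (f - g) ≗ spread f - spread g
spread-- f g zero                = refl
spread-- f g (suc zero)          = refl
spread-- f g (suc (suc zero))    = refl
spread-- f g (suc (suc (suc n))) = spread-- (f ∘ suc) (g ∘ suc) n

spread-• : ∀ c f → spread (c • f) ≗ c • spread f
spread-• c f zero                = refl
spread-• c f (suc zero)          = sym (ℤ.*-zeroʳ c)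
spread-• c f (suc (suc zero))    = sym (ℤ.*-zeroʳ c)
spread-• c f (suc (suc (suc n))) = spread-• c (f ∘ suc) n

-- With y = x³, the factor 1 - x^(3k) becomes 1 - y^k, so the denominator can be treated in the
-- variable y.
Δ-spread : ∀ k f → Δ (k ℕ.* 3) (spread f) ≗ spread (Δ k f)
Δ-spread k f n = trans (cong (λ z → spread f n ℤ.- z) (shiftBy-spread k f n))
  (sym (spread-- f (shiftBy k f) n))

spread-1# : spread 1# ≗ 1#
spread-1# zero                = refl
spread-1# (suc zero)          = refl
spread-1# (suc (suc zero))    = refl
spread-1# (suc (suc (suc n))) = spread-0 n
  where
  spread-0 : spread (λ _ → 0ℤ) ≗ λ _ → 0ℤ
  spread-0 zero                = refl
  spread-0 (suc zero)          = refl
  spread-0 (suc (suc zero))    = refl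
  spread-0 (suc (suc (suc n))) = spread-0 n

spread-x^ : ∀ k → spread (x^ k) ≗ x^ (k ℕ.* 3)
spread-x^ k n = begin
  spread (x^ k) n                 ≡⟨ spread-cong (x^-shiftBy k) n ⟩
  spread (shiftBy k 1#) n         ≡⟨ shiftBy-spread k 1# n ⟨
  shiftBy (k ℕ.* 3) (spread 1#) n ≡⟨ shiftBy-cong (k ℕ.* 3) spread-1# n ⟩
  shiftBy (k ℕ.* 3) 1# n          ≡⟨ x^-shiftBy (k ℕ.* 3) n ⟨
  (x^ (k ℕ.* 3)) n                ∎
  where open ≡-Reasoning

≗-spread : ∀ f g → (∀ c → f (c ℕ.* 3) ≡ g c) → (∀ c → f (1 ℕ.+ c ℕ.* 3) ≡ 0ℤ) →
           (∀ c → f (2 ℕ.+ c ℕ.* 3) ≡ 0ℤ) → f ≗ spread g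
≗-spread f g f₀ f₁ f₂ zero                = f₀ 0
≗-spread f g f₀ f₁ f₂ (suc zero)          = f₁ 0
≗-spread f g f₀ f₁ f₂ (suc (suc zero))    = f₂ 0
≗-spread f g f₀ f₁ f₂ (suc (suc (suc n))) =
  ≗-spread (λ m → f (3 ℕ.+ m)) (g ∘ suc) (f₀ ∘ suc) (f₁ ∘ suc) (f₂ ∘ suc) n

-- The generating function.

squareCount : Series
squareCount c = + 8 ℤ.* + pairCount c

+Mₐ-triple : ∀ c → + Mₐ (c ℕ.* 3) ≡ squareCount c
+Mₐ-triple c = trans (cong +_ (Mₐ-triple c)) (ℤ.pos-* 8 (pairCount c))

∑₊Mₐ-spread : ∑₊ Mₐ ≗ spread squareCount
∑₊Mₐ-spread = ≗-spread (∑₊ Mₐ) squareCount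
  -- At 0 both sides vanish: `∑₊` has no constant term and `pairCount 0` is 0.
  (λ { zero → refl ; (suc c) → +Mₐ-triple (suc c) })
  (λ c → cong +_ (Mₐ-nontriple (1 ℕ.+ c ℕ.* 3) λ eq → contradiction (trans (sym (ℕ.[m+kn]%n≡m%n 1 c 3)) eq) λ ()))
  (λ c → cong +_ (Mₐ-nontriple (2 ℕ.+ c ℕ.* 3) λ eq → contradiction (trans (sym (ℕ.[m+kn]%n≡m%n 2 c 3)) eq) λ ()))

-- Here `p₁` to `p₇` stand for `pairCount` at 1 + c to 7 + c, and the hypotheses are four instances
-- of `pairCount-+3`. The difference of step 3 leaves a linear term plus a floor of a half; the
-- difference of step 2 makes this constant, and that of step 1 kills it.
vanishing : ∀ {p₁ p₂ p₃ p₄ p₅ p₆ p₇} c h₀ h₁ →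
  p₄ ≡ p₁ ℤ.+ (c ℤ.+ h₀) →
  p₅ ≡ p₂ ℤ.+ (+ 1 ℤ.+ c ℤ.+ h₁) →
  p₆ ≡ p₃ ℤ.+ (+ 2 ℤ.+ c ℤ.+ (+ 1 ℤ.+ h₀)) →
  p₇ ≡ p₄ ℤ.+ (+ 3 ℤ.+ c ℤ.+ (+ 1 ℤ.+ h₁)) →
  ((+ 8 ℤ.* p₇ ℤ.- + 8 ℤ.* p₆) ℤ.- (+ 8 ℤ.* p₅ ℤ.- + 8 ℤ.* p₄)) ℤ.-
  ((+ 8 ℤ.* p₄ ℤ.- + 8 ℤ.* p₃) ℤ.- (+ 8 ℤ.* p₂ ℤ.- + 8 ℤ.* p₁)) ≡ 0ℤ
vanishing {p₁} {p₂} {p₃} c h₀ h₁ refl refl refl refl = identity p₁ p₂ p₃ c h₀ h₁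
  where
  identity : ∀ p₁ p₂ p₃ c h₀ h₁ →
    ((+ 8 ℤ.* (p₁ ℤ.+ (c ℤ.+ h₀) ℤ.+ (+ 3 ℤ.+ c ℤ.+ (+ 1 ℤ.+ h₁))) ℤ.-
      + 8 ℤ.* (p₃ ℤ.+ (+ 2 ℤ.+ c ℤ.+ (+ 1 ℤ.+ h₀)))) ℤ.-
     (+ 8 ℤ.* (p₂ ℤ.+ (+ 1 ℤ.+ c ℤ.+ h₁)) ℤ.- + 8 ℤ.* (p₁ ℤ.+ (c ℤ.+ h₀)))) ℤ.-
    ((+ 8 ℤ.* (p₁ ℤ.+ (c ℤ.+ h₀)) ℤ.- + 8 ℤ.* p₃) ℤ.- (+ 8 ℤ.* p₂ ℤ.- + 8 ℤ.* p₁)) ≡ 0ℤ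
  identity = ℤ.solve-∀

-- In y = x³ the right side is 8y⁵(2y + 1). The coefficients up to 6 are computed; from 7 on, all
-- seven indices are positive, so the `pred` in the recurrence does not truncate.
Δ-squareCount : Δ 3 (Δ 2 (Δ 1 squareCount)) ≗ (+ 2) • shift ((+ 8) • x^ 5) + (+ 8) • x^ 5
Δ-squareCount 0 = refl
Δ-squareCount 1 = refl
Δ-squareCount 2 = refl
Δ-squareCount 3 = refl
Δ-squareCount 4 = refl
Δ-squareCount 5 = refl
Δ-squareCount 6 = refl
Δ-squareCount (suc (suc (suc (suc (suc (suc (suc c))))))) =
  vanishing {+ pairCount (1 ℕ.+ c)} {+ pairCount (2 ℕ.+ c)} {+ pairCount (3 ℕ.+ c)}
    (+ c) (+ ℕ.⌊ c /2⌋) (+ ℕ.⌈ c /2⌉)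
    (cong +_ (pairCount-+3 (1 ℕ.+ c))) (cong +_ (pairCount-+3 (2 ℕ.+ c)))
    (cong +_ (pairCount-+3 (3 ℕ.+ c))) (cong +_ (pairCount-+3 (4 ℕ.+ c)))

-- The factor x³ becomes a single `shift` under `spread`, which explains the form
-- `shift ((+ 8) • x^ 5)` in place of a multiple of `x^ 6`.
numerator : (+ 8) • x^ 15 * ((+ 2) • x^ 3 + 1#) ≗ spread ((+ 2) • shift ((+ 8) • x^ 5) + (+ 8) • x^ 5)
numerator n = begin
  (f * ((+ 2) • x^ 3 + 1#)) n
    ≡⟨ *-distribˡ-+ f ((+ 2) • x^ 3) 1# n ⟩
  (f * ((+ 2) • x^ 3)) n ℤ.+ (f * 1#) n
    ≡⟨ cong₂ ℤ._+_ (*-• (+ 2) f (x^ 3) n) (*-identityʳ f n) ⟩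
  (+ 2) ℤ.* (f * x^ 3) n ℤ.+ f n
    ≡⟨ cong₂ (λ y z → (+ 2) ℤ.* y ℤ.+ z) (trans (*-x^ f 3 n) (shiftBy-cong 3 f≗ n)) (f≗ n) ⟩
  (+ 2) ℤ.* shiftBy 3 (spread g) n ℤ.+ spread g n
    ≡⟨ cong (λ z → (+ 2) ℤ.* z ℤ.+ spread g n) (shiftBy-3-spread g n) ⟩
  (+ 2) ℤ.* spread (shift g) n ℤ.+ spread g n
    ≡⟨ cong (ℤ._+ spread g n) (spread-• (+ 2) (shift g) n) ⟨
  spread ((+ 2) • shift g) n ℤ.+ spread g n
    ≡⟨ spread-+ ((+ 2) • shift g) g n ⟨
  spread ((+ 2) • shift g + g) n ∎
  where
  open ≡-Reasoning
  f g : Series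
  f = (+ 8) • x^ 15
  g = (+ 8) • x^ 5
  f≗ : f ≗ spread g
  f≗ m = sym (trans (spread-• (+ 8) (x^ 5) m) (cong ((+ 8) ℤ.*_) (spread-x^ 5 m)))

∑₊Mₐ*denominator :
  ∑₊ Mₐ * ((1# - x^ 3) * (1# - x^ 6) * (1# - x^ 9)) ≗ (+ 8) • x^ 15 * ((+ 2) • x^ 3 + 1#)
∑₊Mₐ*denominator n = begin
  (∑₊ Mₐ * ((1# - x^ 3) * (1# - x^ 6) * (1# - x^ 9))) n
    ≡⟨ *-denominator (∑₊ Mₐ) 3 6 9 n ⟩
  Δ 9 (Δ 6 (Δ 3 (∑₊ Mₐ))) n
    ≡⟨ Δ-cong 9 (Δ-cong 6 (Δ-cong 3 ∑₊Mₐ-spread)) n ⟩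
  Δ 9 (Δ 6 (Δ 3 (spread squareCount))) n
    ≡⟨ Δ-cong 9 (Δ-cong 6 (Δ-spread 1 squareCount)) n ⟩
  Δ 9 (Δ 6 (spread (Δ 1 squareCount))) n
    ≡⟨ Δ-cong 9 (Δ-spread 2 (Δ 1 squareCount)) n ⟩
  Δ 9 (spread (Δ 2 (Δ 1 squareCount))) n
    ≡⟨ Δ-spread 3 (Δ 2 (Δ 1 squareCount)) n ⟩
  spread (Δ 3 (Δ 2 (Δ 1 squareCount))) n
    ≡⟨ spread-cong Δ-squareCount n ⟩
  spread ((+ 2) • shift ((+ 8) • x^ 5) + (+ 8) • x^ 5) n
    ≡⟨ numerator n ⟨
  ((+ 8) • x^ 15 * ((+ 2) • x^ 3 + 1#)) n ∎
  where open ≡-Reasoning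

-- The quasi-polynomial.

Mₐ-quad : ∀ κ c → PairCountFormula κ c → (+ Mₐ (c ℕ.* 3)) / 1 ≡ quad (c ℕ.* 3) (6 ℕ.* κ)
Mₐ-quad κ c formula = fromℚᵘ-cong {mkℚᵘ (+ Mₐ (c ℕ.* 3)) 0} {mkℚᵘ (q (+ (c ℕ.* 3)) (+ (6 ℕ.* κ))) 8} (*≡* (begin
  + Mₐ (c ℕ.* 3) ℤ.* + 9
    ≡⟨ cong (ℤ._* + 9) (+Mₐ-triple c) ⟩
  + 8 ℤ.* + pairCount c ℤ.* + 9
    ≡⟨ expand (+ pairCount c) (+ c) ⟩
  -- Cross-multiplied by the denominators 1 and 9, the count is 72 `pairCount c`, six times the term
  -- in the formula. For t = 3c the other terms are 18c² = 2t² and 96c = 32t.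
  + 6 ℤ.* (+ 12 ℤ.* + pairCount c ℤ.+ + 16 ℤ.* + c) ℤ.- + 96 ℤ.* + c
    ≡⟨ cong (λ z → + 6 ℤ.* z ℤ.- + 96 ℤ.* + c) formulaℤ ⟩
  + 6 ℤ.* (+ 3 ℤ.* (+ c ℤ.* + c) ℤ.+ + κ) ℤ.- + 96 ℤ.* + c
    ≡⟨ collect (+ c) (+ κ) ⟩
  q (+ c ℤ.* + 3) (+ 6 ℤ.* + κ) ℤ.* + 1
    ≡⟨ cong₂ (λ x y → q x y ℤ.* + 1) (ℤ.pos-* c 3) (ℤ.pos-* 6 κ) ⟨
  q (+ (c ℕ.* 3)) (+ (6 ℕ.* κ)) ℤ.* + 1 ∎))
  where
  open ≡-Reasoning
  q : ℤ → ℤ → ℤ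
  q t k = + 2 ℤ.* t ℤ.^ 2 ℤ.- + 32 ℤ.* t ℤ.+ k
  expand : ∀ p c → + 8 ℤ.* p ℤ.* + 9 ≡ + 6 ℤ.* (+ 12 ℤ.* p ℤ.+ + 16 ℤ.* c) ℤ.- + 96 ℤ.* c
  expand = ℤ.solve-∀
  -- The square is spelled out as `t ℤ.^ 2` evaluates, with a trailing factor `1ℤ`.
  collect : ∀ c κ → + 6 ℤ.* (+ 3 ℤ.* (c ℤ.* c) ℤ.+ κ) ℤ.- + 96 ℤ.* c ≡
            (+ 2 ℤ.* (c ℤ.* + 3 ℤ.* (c ℤ.* + 3 ℤ.* 1ℤ)) ℤ.- + 32 ℤ.* (c ℤ.* + 3) ℤ.+ + 6 ℤ.* κ) ℤ.* + 1
  collect = ℤ.solve-∀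
  formulaℤ : + 12 ℤ.* + pairCount c ℤ.+ + 16 ℤ.* + c ≡ + 3 ℤ.* (+ c ℤ.* + c) ℤ.+ + κ
  formulaℤ = begin
    + 12 ℤ.* + pairCount c ℤ.+ + 16 ℤ.* + c
      ≡⟨ cong₂ ℤ._+_ (ℤ.pos-* 12 (pairCount c)) (ℤ.pos-* 16 c) ⟨
    + (12 ℕ.* pairCount c ℕ.+ 16 ℕ.* c)
      ≡⟨ cong +_ formula ⟩
    + (3 ℕ.* (c ℕ.* c) ℕ.+ κ)
      ≡⟨ cong (ℤ._+ + κ) (trans (ℤ.pos-* 3 (c ℕ.* c)) (cong (+ 3 ℤ.*_) (ℤ.pos-* c c))) ⟩
    + 3 ℤ.* (+ c ℤ.* + c) ℤ.+ + κ ∎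

residue : ∀ {t} r → t % 18 ≡ r ℕ.* 3 → t ≡ (r ℕ.+ t ℕ./ 18 ℕ.* 6) ℕ.* 3
residue {t} r eq = trans (ℕ.m≡m%n+[m/n]*n t 18)
  (trans (cong (ℕ._+ t ℕ./ 18 ℕ.* 18) eq) (regroup r (t ℕ./ 18)))
  where
  regroup : ∀ r k → r ℕ.* 3 ℕ.+ k ℕ.* 18 ≡ (r ℕ.+ k ℕ.* 6) ℕ.* 3
  regroup = ℕ.solve-∀

Mₐ-quad-residue : ∀ κ r → PairCountFormula κ (1 ℕ.+ r) → ∀ t → t % 18 ≡ (1 ℕ.+ r) ℕ.* 3 →
                  (+ Mₐ t) / 1 ≡ quad t (6 ℕ.* κ)
Mₐ-quad-residue κ r base t eq =
  subst (λ t → (+ Mₐ t) / 1 ≡ quad t (6 ℕ.* κ)) (sym (residue {t} (1 ℕ.+ r) eq))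
    (Mₐ-quad κ (1 ℕ.+ r ℕ.+ t ℕ./ 18 ℕ.* 6) (pairCount-closed {κ} r (t ℕ./ 18) base))

-- For t ≡ 0 (mod 18) the induction starts at t = 18: the formula fails at t = 0.
Mₐ-quad-0 : ∀ t → 1 ≤ t → t % 18 ≡ 0 → (+ Mₐ t) / 1 ≡ quad t 144
Mₐ-quad-0 t 1≤t eq = from-quotient (t ℕ./ 18) (residue {t} 0 eq)
  where
  from-quotient : ∀ k → t ≡ k ℕ.* 6 ℕ.* 3 → (+ Mₐ t) / 1 ≡ quad t 144
  from-quotient zero    t≡0 = contradiction (sym t≡0) (ℕ.<⇒≢ 1≤t)
  from-quotient (suc k) t≡  = subst (λ t → (+ Mₐ t) / 1 ≡ quad t 144) (sym t≡)
    (Mₐ-quad 24 (suc k ℕ.* 6) (pairCount-closed {24} 5 k refl))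

mainTheorem2 : (∑₊ Mₐ ≗
    ((+ 8) • x^ 15 * ((+ 2) • x^ 3 + 1#)) / ((1# - x^ 3) * (1# - x^ 6) * (1# - x^ 9)) [ refl ])
    ×
    (∀ (t : ℕ) → 1 ≤ t →
    (t % 18 ≡ 0  → (+ Mₐ t) / 1 ≡ quad t 144) ×
    (t % 18 ≡ 3  → (+ Mₐ t) / 1 ≡ quad t 78) ×
    (t % 18 ≡ 6  → (+ Mₐ t) / 1 ≡ quad t 120) ×
    (t % 18 ≡ 9  → (+ Mₐ t) / 1 ≡ quad t 126) ×
    (t % 18 ≡ 12 → (+ Mₐ t) / 1 ≡ quad t 96) ×
    (t % 18 ≡ 15 → (+ Mₐ t) / 1 ≡ quad t 102) ×
    (¬ (t % 3 ≡ 0) → Mₐ t ≡ 0))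
mainTheorem2 =
  /-unique (∑₊ Mₐ) ((+ 8) • x^ 15 * ((+ 2) • x^ 3 + 1#)) ((1# - x^ 3) * (1# - x^ 6) * (1# - x^ 9)) refl
    ∑₊Mₐ*denominator ,
  λ t 1≤t →
    Mₐ-quad-0 t 1≤t ,
    -- Each `κ` is a sixth of the constant in the statement. The base cases c = 1 to 5 hold by
    -- evaluation; only c = 5 has an admissible pair.
    Mₐ-quad-residue 13 0 refl t ,
    Mₐ-quad-residue 20 1 refl t ,
    Mₐ-quad-residue 21 2 refl t ,
    Mₐ-quad-residue 16 3 refl t ,
    Mₐ-quad-residue 17 4 refl t ,
    Mₐ-nontriple t
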